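{- Let $n,k,r$ be integers with $k,r\geq 2$, $n\geq 2k$ and $k<r$. Then every vertex-$k$-maximal $r$-uniform hypergraph $H$ on $n$ vertices satisfies $|E(H)|\leq \binom{n}{r}-\binom{n-k}{r}$ (which equals $\binom{n}{r}-\binom{n-k}{r}+(\frac{n}{k}-2)\binom{k}{r}$ since $\binom{k}{r}=0$).
   Context: Binomial coefficients satisfy $\binom{a}{b}=0$ when $b>a$. A hypergraph $H=(V,E)$ consists of a finite vertex set $V$ and a set $E$ of non-empty subsets of $V$ (edges); it is $r$-uniform if all edges have exactly $r$ elements. The complement $H^c$ has as edges the $r$-subsets of $V$ not in $E$. A subhypergraph is $H'=(V',E')$ with $V'\subseteq V$, $E'\subseteq E$. $H+e=(V,E\cup\{e\})$ for $e\in E(H^c)$. $H-Y$ is the hypergraph induced on $V\setminus Y$ (keeping edges contained in $V\setminus Y$). Connectedness is defined via paths (alternating sequences of distinct vertices and distinct edges with consecutive vertices in the intermediate edge). A vertex-cut is a set $X$ with $H-X$ disconnected. $\kappa(H)$ is the minimum size of a vertex-cut if one exists, and $|V(H)|-1$ otherwise. $\overline{\kappa}(H)=\max\{\kappa(H'): H'\subseteq H\}$. An $r$-uniform hypergraph $H$ is vertex-$k$-maximal if $\overline{\kappa}(H)\leq k$ but $\overline{\kappa}(H+e)\geq k+1$ for every $e\in E(H^c)$. -}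

module Defs where

open import Data.Fin.Base using (Fin)
open import Data.Fin.Properties using (any?; all?; injective⇒≤) renaming (_≟_ to _≟ᶠ_)
open import Data.Fin.Subset using (Subset; inside; outside; _∈_; _⊆_; _─_; ∣_∣; Nonempty)
open import Data.Fin.Subset.Properties using (_∈?_; _⊆?_; nonempty?)
open import Data.Bool.Properties using () renaming (_≟_ to _≟ᵇ_)
open import Data.Integer.Base using (+_)
open import Data.List.Base using (List; []; _∷_; [_]; _++_; map; filter; length; lookup; allFin; cartesianProductWith)
open import Data.List.Extrema.Nat using (min; max; min≤v⁺; argmin-sel; v≤max⁺; argmax-sel)
open import Data.List.Membership.Propositional using () renaming (_∈_ to _∈ₗ_; _∉_ to _∉ₗ_)
open import Data.List.Membership.Propositional.Properties using (∈-map⁺; ∈-map⁻; ∈-++⁺ˡ; ∈-++⁺ʳ; ∈-filter⁺; ∈-filter⁻; ∈-cartesianProductWith⁺; ∈-cartesianProductWith⁻; ∈-lookup; ∈-allFin)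
open import Data.List.Properties using (filter-≐)
open import Data.List.Relation.Binary.Subset.Propositional using () renaming (_⊆_ to _⊆ₗ_)
open import Data.List.Relation.Unary.All using (All; []; _∷_)
import Data.List.Relation.Unary.All as All
import Data.List.Relation.Unary.All.Properties as AllP
open import Data.List.Relation.Unary.AllPairs using ([]; _∷_)
open import Data.List.Relation.Unary.Any using (Any; here; there)
import Data.List.Relation.Unary.Any as Any
open import Data.List.Relation.Unary.Any.Properties using (lookup-index)
open import Data.List.Relation.Unary.Unique.Propositional using (Unique)
import Data.List.Relation.Unary.Unique.Propositional.Properties as Uniq
import Data.List.Relation.Unary.Unique.DecPropositional as DecUnique
import Data.List.Membership.DecPropositional as DecMembership
open import Data.Nat.Base using (ℕ; zero; suc; _≤_; _∸_; s≤s)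
open import Data.Nat.Properties using (≤-refl; ≤-reflexive; n≤0⇒n≡0) renaming (_≟_ to _≟ⁿ_)
open import Data.Product.Base using (_×_; _,_; ∃; proj₁; proj₂)
open import Data.Rational.Base using (ℚ; _/_)
open import Data.Sum.Base using (inj₁; inj₂)
open import Data.Vec.Base using ([]; _∷_)
open import Data.Vec.Properties using (∷-injectiveʳ) renaming (≡-dec to vec-≡-dec)
open import Function.Base using (_∘_)
open import Relation.Binary.Definitions using (DecidableEquality)
open import Relation.Binary.PropositionalEquality using (_≡_; refl; sym; trans; cong; cong₂; subst)
open import Relation.Nullary using (¬_; Dec; yes; no; contradiction)
open import Relation.Nullary.Decidable using (map′; _×-dec_; _→-dec_; ¬?)
open import Relation.Unary using (Decidable)

private
  variable
    n : ℕ
    A : Set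

_≟ˢ_ : DecidableEquality (Subset n)
_≟ˢ_ = vec-≡-dec _≟ᵇ_

_∈ₗ?_ : (e : Subset n) (es : List (Subset n)) → Dec (e ∈ₗ es)
_∈ₗ?_ = DecMembership._∈?_ _≟ˢ_

subsets : ∀ n → List (Subset n)
subsets zero    = [ [] ]
subsets (suc n) = map (inside ∷_) (subsets n) ++ map (outside ∷_) (subsets n)

∈-subsets : (p : Subset n) → p ∈ₗ subsets n
∈-subsets []            = here refl
∈-subsets (inside ∷ p)  = ∈-++⁺ˡ (∈-map⁺ (inside ∷_) (∈-subsets p))
∈-subsets (outside ∷ p) = ∈-++⁺ʳ _ (∈-map⁺ (outside ∷_) (∈-subsets p))

subsets-unique : ∀ n → Unique (subsets n)
subsets-unique zero    = [] ∷ []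
subsets-unique (suc n) = Uniq.++⁺
  (Uniq.map⁺ ∷-injectiveʳ (subsets-unique n))
  (Uniq.map⁺ ∷-injectiveʳ (subsets-unique n))
  λ (p , q) → disjoint (∈-map⁻ (inside ∷_) p) (∈-map⁻ (outside ∷_) q)
  where
  disjoint : ∀ {p : Subset (suc n)} →
             ∃ (λ x → x ∈ₗ subsets n × p ≡ inside ∷ x) →
             ¬ ∃ (λ y → y ∈ₗ subsets n × p ≡ outside ∷ y)
  disjoint (_ , _ , refl) (_ , _ , ())

sublists : List A → List (List A)
sublists []       = [ [] ]
sublists (x ∷ xs) = map (x ∷_) (sublists xs) ++ sublists xs

filter∈sublists : {P : A → Set} (P? : Decidable P) (xs : List A) → filter P? xs ∈ₗ sublists xs
filter∈sublists P? []       = here refl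
filter∈sublists P? (x ∷ xs) with P? x
... | yes _ = ∈-++⁺ˡ (∈-map⁺ (x ∷_) (filter∈sublists P? xs))
... | no  _ = ∈-++⁺ʳ _ (filter∈sublists P? xs)

listsUpTo : List A → ℕ → List (List A)
listsUpTo xs zero    = [ [] ]
listsUpTo xs (suc m) = [] ∷ cartesianProductWith _∷_ xs (listsUpTo xs m)

∈-listsUpTo : ∀ {xs : List A} m {ys} → All (_∈ₗ xs) ys → length ys ≤ m → ys ∈ₗ listsUpTo xs m
∈-listsUpTo zero    []       _       = here refl
∈-listsUpTo (suc m) []       _       = here refl
∈-listsUpTo (suc m) (p ∷ ps) (s≤s l) = there (∈-cartesianProductWith⁺ _∷_ p (∈-listsUpTo m ps l))

lookup-injective : {xs : List A} → Unique xs → ∀ {i j} → lookup xs i ≡ lookup xs j → i ≡ j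
lookup-injective {xs = x ∷ xs} _         {Fin.zero}  {Fin.zero}  _  = refl
lookup-injective {xs = x ∷ xs} (x≢ ∷ _)  {Fin.zero}  {Fin.suc j} eq = contradiction eq (All.lookup x≢ (∈-lookup j))
lookup-injective {xs = x ∷ xs} (x≢ ∷ _)  {Fin.suc i} {Fin.zero}  eq = contradiction (sym eq) (All.lookup x≢ (∈-lookup i))
lookup-injective {xs = x ∷ xs} (_ ∷ uxs) {Fin.suc i} {Fin.suc j} eq = cong Fin.suc (lookup-injective uxs eq)

unique⇒length≤ : {xs ys : List A} → Unique ys → All (_∈ₗ xs) ys → length ys ≤ length xs
unique⇒length≤ {xs = xs} {ys} u ps = injective⇒≤ {f = f} λ {i} {j} eq →
  lookup-injective u (trans (at i) (trans (cong (lookup xs) eq) (sym (at j))))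
  where
  f : Fin (length ys) → Fin (length xs)
  f i = Any.index (All.lookup ps (∈-lookup i))
  at : ∀ i → lookup ys i ≡ lookup xs (f i)
  at i = lookup-index (All.lookup ps (∈-lookup i))

-- The vertex set is a subset V of an ambient Fin n, so that the
-- subhypergraphs of a hypergraph have the same type as the hypergraph.
-- The edge set is a duplicate-free list, whose order is irrelevant.

record Hypergraph (n : ℕ) : Set where
  field
    V        : Subset n
    E        : List (Subset n)
    distinct : Unique E
    edge⊆V   : ∀ {e} → e ∈ₗ E → e ⊆ V
    nonempty : ∀ {e} → e ∈ₗ E → Nonempty e

open Hypergraph public

order : Hypergraph n → ℕ
order H = ∣ V H ∣

size : Hypergraph n → ℕ
size H = length (E H)

Uniform : ℕ → Hypergraph n → Set
Uniform r H = ∀ {e} → e ∈ₗ E H → ∣ e ∣ ≡ r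

infix 4 _⊑_

_⊑_ : Hypergraph n → Hypergraph n → Set
H′ ⊑ H = V H′ ⊆ V H × E H′ ⊆ₗ E H

-- Edges are non-empty by definition, so the empty set is excluded; this
-- only has an effect for r = 0.

ComplementEdge : ℕ → Hypergraph n → Subset n → Set
ComplementEdge r H e = e ⊆ V H × ∣ e ∣ ≡ r × Nonempty e × e ∉ₗ E H

complementEdge? : ∀ r (H : Hypergraph n) → Decidable (ComplementEdge r H)
complementEdge? r H e = (e ⊆? V H) ×-dec (∣ e ∣ ≟ⁿ r) ×-dec nonempty? e ×-dec ¬? (e ∈ₗ? E H)

complement : ℕ → Hypergraph n → Hypergraph n
complement {n} r H = record
  { V        = V H
  ; E        = filter (complementEdge? r H) (subsets n)
  ; distinct = Uniq.filter⁺ (complementEdge? r H) (subsets-unique n)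
  ; edge⊆V   = λ e∈ → proj₁ (spec e∈)
  ; nonempty = λ e∈ → proj₁ (proj₂ (proj₂ (spec e∈)))
  }
  where
  spec : ∀ {e} → e ∈ₗ filter (complementEdge? r H) (subsets n) → ComplementEdge r H e
  spec e∈ = proj₂ (∈-filter⁻ (complementEdge? r H) {xs = subsets n} e∈)

addEdge : ∀ {r} (H : Hypergraph n) {e} → e ∈ₗ E (complement r H) → Hypergraph n
addEdge {n} {r} H {e} e∈Hᶜ = record
  { V        = V H
  ; E        = e ∷ E H
  ; distinct = AllP.¬Any⇒All¬ _ (proj₂ (proj₂ (proj₂ spec))) ∷ distinct H
  ; edge⊆V   = λ { (here refl) → edge⊆V (complement r H) e∈Hᶜ ; (there f∈) → edge⊆V H f∈ }
  ; nonempty = λ { (here refl) → nonempty (complement r H) e∈Hᶜ ; (there f∈) → nonempty H f∈ }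
  }
  where
  spec : ComplementEdge r H e
  spec = proj₂ (∈-filter⁻ (complementEdge? r H) {xs = subsets n} e∈Hᶜ)

infixl 6 _−_

_−_ : Hypergraph n → Subset n → Hypergraph n
H − Y = record
  { V        = V H ─ Y
  ; E        = filter (_⊆? (V H ─ Y)) (E H)
  ; distinct = Uniq.filter⁺ (_⊆? (V H ─ Y)) (distinct H)
  ; edge⊆V   = λ e∈ → proj₂ (∈-filter⁻ (_⊆? (V H ─ Y)) {xs = E H} e∈)
  ; nonempty = λ e∈ → nonempty H (proj₁ (∈-filter⁻ (_⊆? (V H ─ Y)) {xs = E H} e∈))
  }

-- Walk H u v (x₀ ∷ … ∷ xₛ ∷ []) (e₁ ∷ … ∷ eₛ ∷ []) says that
-- x₀ e₁ x₁ … eₛ xₛ is an alternating sequence from u = x₀ to v = xₛ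
-- with xᵢ₋₁ and xᵢ both in the edge eᵢ.

data Walk (H : Hypergraph n) : Fin n → Fin n → List (Fin n) → List (Subset n) → Set where
  stop : ∀ {v} → v ∈ V H → Walk H v v [ v ] []
  step : ∀ {u w v e xs es} → e ∈ₗ E H → u ∈ e → w ∈ e →
         Walk H w v xs es → Walk H u v (u ∷ xs) (e ∷ es)

record Path (H : Hypergraph n) (u v : Fin n) : Set where
  field
    vertices          : List (Fin n)
    edges             : List (Subset n)
    walk              : Walk H u v vertices edges
    vertices-distinct : Unique vertices
    edges-distinct    : Unique edges

Connected : Hypergraph n → Set
Connected H = ∀ u v → u ∈ V H → v ∈ V H → Path H u v

VertexCut : Hypergraph n → Subset n → Set
VertexCut H X = X ⊆ V H × ¬ Connected (H − X)

walk? : (H : Hypergraph n) (u v : Fin n) (xs : List (Fin n)) (es : List (Subset n)) → Dec (Walk H u v xs es)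
walk? H u v []           es      = no λ ()
walk? H u v (x ∷ y ∷ xs) []      = no λ ()
walk? H u v (x ∷ [])     []      = map′
  (λ { (refl , refl , p) → stop p }) (λ { (stop p) → refl , refl , p })
  ((x ≟ᶠ u) ×-dec (u ≟ᶠ v) ×-dec (v ∈? V H))
walk? H u v (x ∷ xs) (e ∷ es) = map′
  (λ { (refl , e∈ , u∈ , _ , w∈ , π) → step e∈ u∈ w∈ π })
  (λ { (step e∈ u∈ w∈ π) → refl , e∈ , u∈ , _ , w∈ , π })
  ((x ≟ᶠ u) ×-dec (e ∈ₗ? E H) ×-dec (u ∈? e) ×-dec any? (λ w → (w ∈? e) ×-dec walk? H w v xs es))

walk-edges : ∀ {H : Hypergraph n} {u v xs es} → Walk H u v xs es → All (_∈ₗ E H) es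
walk-edges (stop _)         = []
walk-edges (step e∈ _ _ π) = e∈ ∷ walk-edges π

path? : (H : Hypergraph n) (u v : Fin n) → Dec (Path H u v)
path? {n} H u v = map′ to from
  (Any.any? (λ xs → Any.any? (good? xs) edgeLists) vertexLists)
  where
  vertexLists : List (List (Fin n))
  vertexLists = listsUpTo (allFin n) (length (allFin n))
  edgeLists : List (List (Subset n))
  edgeLists = listsUpTo (E H) (length (E H))
  Good : List (Fin n) → List (Subset n) → Set
  Good xs es = Walk H u v xs es × Unique xs × Unique es
  good? : ∀ xs es → Dec (Good xs es)
  good? xs es = walk? H u v xs es ×-dec DecUnique.unique? _≟ᶠ_ xs ×-dec DecUnique.unique? _≟ˢ_ es
  to : Any (λ xs → Any (Good xs) edgeLists) vertexLists → Path H u v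
  to p with Any.satisfied p
  ... | _ , q with Any.satisfied q
  ... | _ , π , ux , ue = record { walk = π ; vertices-distinct = ux ; edges-distinct = ue }
  from : Path H u v → Any (λ xs → Any (Good xs) edgeLists) vertexLists
  from p = Any.map (λ { refl → Any.map (λ { refl → walk , vertices-distinct , edges-distinct }) es∈ }) xs∈
    where
    open Path p
    all∈ : All (_∈ₗ allFin n) vertices
    all∈ = All.tabulate λ {x} _ → ∈-allFin x
    xs∈ : vertices ∈ₗ vertexLists
    xs∈ = ∈-listsUpTo _ all∈ (unique⇒length≤ vertices-distinct all∈)
    es∈ : edges ∈ₗ edgeLists
    es∈ = ∈-listsUpTo _ (walk-edges walk) (unique⇒length≤ edges-distinct (walk-edges walk))

connected? : (H : Hypergraph n) → Dec (Connected H)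
connected? H = all? λ u → all? λ v → (u ∈? V H) →-dec ((v ∈? V H) →-dec path? H u v)

vertexCut? : (H : Hypergraph n) → Decidable (VertexCut H)
vertexCut? H X = (X ⊆? V H) ×-dec ¬? (connected? (H − X))

minimumOr : ℕ → List ℕ → ℕ
minimumOr d []       = d
minimumOr d (x ∷ xs) = min x xs

vertexCuts : Hypergraph n → List (Subset n)
vertexCuts {n} H = filter (vertexCut? H) (subsets n)

-- On the hypergraph without vertices the truncated subtraction makes
-- this 0.

κ : Hypergraph n → ℕ
κ H = minimumOr (order H ∸ 1) (map ∣_∣ (vertexCuts H))

subEdge? : (V′ : Subset n) (F : List (Subset n)) → Decidable (λ e → e ∈ₗ F × e ⊆ V′)
subEdge? V′ F e = (e ∈ₗ? F) ×-dec (e ⊆? V′)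

-- The subhypergraph with vertex set V′ and edge set F ⊆ E H, except that the
-- edges in F not contained in V′ are dropped.

sub : Hypergraph n → Subset n → List (Subset n) → Hypergraph n
sub H V′ F = record
  { V        = V′
  ; E        = filter (subEdge? V′ F) (E H)
  ; distinct = Uniq.filter⁺ (subEdge? V′ F) (distinct H)
  ; edge⊆V   = λ e∈ → proj₂ (proj₂ (∈-filter⁻ (subEdge? V′ F) {xs = E H} e∈))
  ; nonempty = λ e∈ → nonempty H (proj₁ (∈-filter⁻ (subEdge? V′ F) {xs = E H} e∈))
  }

subhypergraphs : Hypergraph n → List (Hypergraph n)
subhypergraphs {n} H = cartesianProductWith (sub H) (filter (_⊆? V H) (subsets n)) (sublists (E H))

-- The maximum of κ over all subhypergraphs: see κ̄-upper and κ̄-attained.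

κ̄ : Hypergraph n → ℕ
κ̄ H = max 0 (map κ (subhypergraphs H))

VertexMaximal : ℕ → ℕ → Hypergraph n → Set
VertexMaximal k r H =
  Uniform r H ×
  κ̄ H ≤ k ×
  (∀ {e} (e∈Hᶜ : e ∈ₗ E (complement r H)) → suc k ≤ κ̄ (addEdge {r = r} H e∈Hᶜ))

toℚ : ℕ → ℚ
toℚ m = + m / 1

minimumOr-≤ : ∀ d {x xs} → x ∈ₗ xs → minimumOr d xs ≤ x
minimumOr-≤ d {xs = y ∷ ys} (here refl) = min≤v⁺ y ys (inj₁ ≤-refl)
minimumOr-≤ d {xs = y ∷ ys} (there x∈)  = min≤v⁺ y ys (inj₂ (Any.map (≤-reflexive ∘ sym) x∈))

minimumOr-∈ : ∀ d {x xs} → x ∈ₗ xs → minimumOr d xs ∈ₗ xs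
minimumOr-∈ d {xs = y ∷ ys} _ with argmin-sel (λ z → z) y ys
... | inj₁ eq = here eq
... | inj₂ m∈ = there m∈

κ-lower : (H : Hypergraph n) → ∀ {X} → VertexCut H X → κ H ≤ ∣ X ∣
κ-lower H {X} cut = minimumOr-≤ _ (∈-map⁺ ∣_∣ (∈-filter⁺ (vertexCut? H) (∈-subsets X) cut))

κ-attained : (H : Hypergraph n) → ∃ (VertexCut H) → ∃ λ X → VertexCut H X × κ H ≡ ∣ X ∣
κ-attained {n} H (X , cut)
  with ∈-map⁻ ∣_∣ (minimumOr-∈ (order H ∸ 1) (∈-map⁺ ∣_∣ (∈-filter⁺ (vertexCut? H) (∈-subsets X) cut)))
... | Y , Y∈ , eq = Y , proj₂ (∈-filter⁻ (vertexCut? H) {xs = subsets n} Y∈) , eq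

κ-uncut : (H : Hypergraph n) → ¬ ∃ (VertexCut H) → κ H ≡ order H ∸ 1
κ-uncut {n} H none with vertexCuts H in eq
... | []     = refl
... | X ∷ _ = contradiction
  (X , proj₂ (∈-filter⁻ (vertexCut? H) {xs = subsets n} (subst (X ∈ₗ_) (sym eq) (here refl)))) none

walk-mono : {H K : Hypergraph n} → V H ≡ V K → E H ⊆ₗ E K →
            ∀ {u v xs es} → Walk H u v xs es → Walk K u v xs es
walk-mono eq E⊆ (stop {v} v∈)        = stop (subst (v ∈_) eq v∈)
walk-mono eq E⊆ (step e∈ u∈ w∈ π) = step (E⊆ e∈) u∈ w∈ (walk-mono eq E⊆ π)

connected-mono : {H K : Hypergraph n} → V H ≡ V K → E H ⊆ₗ E K → Connected H → Connected K
connected-mono {H = H} {K} eq E⊆ conn u v u∈ v∈ = record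
  { walk              = walk-mono {H = H} {K} eq E⊆ walk
  ; vertices-distinct = vertices-distinct
  ; edges-distinct    = edges-distinct
  }
  where open Path (conn u v (subst (u ∈_) (sym eq) u∈) (subst (v ∈_) (sym eq) v∈))

vertexCut-anti : {H K : Hypergraph n} → V H ≡ V K → E H ⊆ₗ E K → ∀ {X} → VertexCut K X → VertexCut H X
vertexCut-anti {H = H} {K} eq E⊆ {X} (X⊆ , disc) =
  subst (X ⊆_) (sym eq) X⊆ ,
  λ conn → disc (connected-mono {H = H − X} {K − X} (cong (_─ X) eq) edges⊆ conn)
  where
  edges⊆ : E (H − X) ⊆ₗ E (K − X)
  edges⊆ {e} e∈ with ∈-filter⁻ (_⊆? (V H ─ X)) {xs = E H} e∈
  ... | e∈E , e⊆ = ∈-filter⁺ (_⊆? (V K ─ X)) (E⊆ e∈E) (subst (λ W → e ⊆ W ─ X) eq e⊆)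

κ-cong : {H K : Hypergraph n} → V H ≡ V K → E H ⊆ₗ E K → E K ⊆ₗ E H → κ H ≡ κ K
κ-cong {n} {H} {K} eq ⊆₁ ⊆₂ = cong₂ minimumOr (cong (λ W → ∣ W ∣ ∸ 1) eq)
  (cong (map ∣_∣) (filter-≐ (vertexCut? H) (vertexCut? K)
    (vertexCut-anti {H = K} {H} (sym eq) ⊆₂ , vertexCut-anti {H = H} {K} eq ⊆₁) (subsets n)))

sub-⊑ : (H : Hypergraph n) → ∀ {K} → K ∈ₗ subhypergraphs H → K ⊑ H
sub-⊑ {n} H K∈
  with ∈-cartesianProductWith⁻ (sub H) (filter (_⊆? V H) (subsets n)) (sublists (E H)) K∈
... | V′ , F , V′∈ , _ , refl =
  proj₂ (∈-filter⁻ (_⊆? V H) {xs = subsets n} V′∈) ,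
  λ e∈ → proj₁ (∈-filter⁻ (subEdge? V′ F) {xs = E H} e∈)

κ̄-upper : (H H′ : Hypergraph n) → H′ ⊑ H → κ H′ ≤ κ̄ H
κ̄-upper {n} H H′ (V⊆ , E⊆) = v≤max⁺ 0 _ (inj₂ (Any.map ≤-reflexive
  (subst (_∈ₗ map κ (subhypergraphs H)) (sym same) (∈-map⁺ κ listed))))
  where
  F : List (Subset n)
  F = filter (_∈ₗ? E H′) (E H)
  listed : sub H (V H′) F ∈ₗ subhypergraphs H
  listed = ∈-cartesianProductWith⁺ (sub H)
    (∈-filter⁺ (_⊆? V H) (∈-subsets (V H′)) V⊆) (filter∈sublists (_∈ₗ? E H′) (E H))
  same : κ H′ ≡ κ (sub H (V H′) F)
  same = κ-cong {H = H′} {sub H (V H′) F} refl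
    (λ e∈ → ∈-filter⁺ (subEdge? (V H′) F) (E⊆ e∈)
      (∈-filter⁺ (_∈ₗ? E H′) (E⊆ e∈) e∈ , λ {x} → edge⊆V H′ e∈ {x}))
    (λ e∈ → proj₂ (∈-filter⁻ (_∈ₗ? E H′) {xs = E H}
      (proj₁ (proj₂ (∈-filter⁻ (subEdge? (V H′) F) {xs = E H} e∈)))))

κ̄-attained : (H : Hypergraph n) → ∃ λ H′ → H′ ⊑ H × κ̄ H ≡ κ H′
κ̄-attained H with argmax-sel (λ x → x) 0 (map κ (subhypergraphs H))
... | inj₁ κ̄≡0 = H , ((λ x∈ → x∈) , (λ e∈ → e∈)) ,
  trans κ̄≡0 (sym (n≤0⇒n≡0 (subst (κ H ≤_) κ̄≡0 (κ̄-upper H H ((λ x∈ → x∈) , (λ e∈ → e∈))))))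
... | inj₂ m∈ with ∈-map⁻ κ m∈
... | K , K∈ , eq = K , sub-⊑ H K∈ , eq

{-# OPTIONS --safe #-}
-- By induction on ∣W∣, κ̄ H ≤ k forces at least C(∣W∣ − k, r) of the r-subsets of
-- any vertex set W to be non-edges: if ∣W∣ ≥ k + r, then W has a cut X with
-- ∣X∣ ≤ k, splitting W − X into parts A and B with no edges across. As ∣X∣ < r,
-- no r-set lies in both A ∪ X and B ∪ X, so the non-edges inside A ∪ X, those
-- inside B ∪ X and the r-subsets of A ∪ B meeting both A and B are disjoint
-- families of non-edges, and superadditivity of binomials gives the bound.
module Submission where

open import Defs
open import Data.Bool.Base using (if_then_else_)
open import Data.Fin.Base using (Fin)
open import Data.Fin.Properties using (all?; ¬∀⟶∃¬) renaming (_≟_ to _≟ᶠ_)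
open import Data.Fin.Subset using (Subset; inside; outside; _∈_; _∉_; _⊆_; _∪_; _─_; ∣_∣; Nonempty)
open import Data.Fin.Subset.Properties
  using (_∈?_; _⊆?_; drop-∷-⊆; in⊆in; out⊆; p⊆q⇒∣p∣≤∣q∣; p⊂q⇒∣p∣<∣q∣; x∈p∪q⁻; x∈p∪q⁺;
         p─q⊆p; x∈p∧x∉q⇒x∈p─q; ⊆-antisym)
open import Data.Integer.Base using (+_)
import Data.Integer.Base as ℤ
import Data.Integer.Properties as ℤ
open import Data.List.Base using (List; []; _∷_; _++_; map; filter; length)
open import Data.List.Membership.Propositional using () renaming (_∈_ to _∈ₗ_; _∉_ to _∉ₗ_)
open import Data.List.Membership.Propositional.Properties using (∈-filter⁺; ∈-filter⁻)
import Data.List.Membership.DecPropositional as DecMembership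
open import Data.List.Properties using (map-++; map-∘)
open import Data.List.Relation.Unary.All using ([]; _∷_)
import Data.List.Relation.Unary.All as All
import Data.List.Relation.Unary.All.Properties as All
open import Data.List.Relation.Unary.AllPairs using ([]; _∷_)
open import Data.List.Relation.Unary.Any using (here; there)
import Data.List.Relation.Unary.Any as Any
open import Data.List.Relation.Unary.Unique.Propositional using (Unique)
open import Data.Nat.Base using (ℕ; zero; suc; pred; NonZero; _≤_; _<_; _∸_; z≤n; s≤s) renaming (_*_ to _*ⁿ_; _+_ to _+ⁿ_)
open import Data.Nat.Combinatorics using (_C_; nCk+nC[k+1]≡[n+1]C[k+1]; k>n⇒nCk≡0)
open import Data.Nat.Induction using (<-wellFounded)
open import Data.Nat.ListAction using (sum)
open import Data.Nat.ListAction.Properties using (sum-++)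
import Data.Nat.Properties as ℕ
open import Algebra.Properties.CommutativeSemigroup ℕ.+-commutativeSemigroup using (interchange)
open import Data.Nat.Tactic.RingSolver using (solve-∀)
open import Data.Product.Base using (_×_; _,_; ∃; proj₁; proj₂)
open import Data.Rational.Base using (_+_; _-_; _*_; _/_; -_; 0ℚ; toℚᵘ)
import Data.Rational.Properties as ℚ
import Data.Rational.Unnormalised.Base as ℚᵘ
import Data.Rational.Unnormalised.Properties as ℚᵘ
open import Data.Sum.Base using (_⊎_; inj₁; inj₂; [_,_]′)
open import Data.Vec.Base using ([]; _∷_; here; there; tabulate)
open import Data.Vec.Properties using ([]=⇒lookup; lookup⇒[]=; lookup∘tabulate)
open import Function.Base using (_∘_; id)
open import Induction.WellFounded using (Acc; acc)
open import Relation.Binary.PropositionalEquality using (_≡_; refl; sym; trans; cong; cong₂; subst; module ≡-Reasoning)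
open import Relation.Nullary using (¬_; Dec; does; yes; no; contradiction)
open import Relation.Nullary.Decidable using (_×-dec_; _⊎-dec_; _→-dec_; ¬?; dec-true; decidable-stable; toSum)
open import Relation.Unary using (Decidable)

private
  variable
    N : ℕ
    I P Q R : Set

-- Binomial coefficients

-- Pascal's rule written with `pred`, so that it also covers `n = 0` and can be applied to truncated
-- differences. At `n = 0` the hypothesis `1 ≤ k` matters, since `0 C 0` is 1.
nC[1+k]≡pred : ∀ n {k} → 1 ≤ k → n C suc k ≡ pred n C k +ⁿ pred n C suc k
nC[1+k]≡pred zero    {suc k} _ = refl
nC[1+k]≡pred (suc n) {k}     _ = sym (nCk+nC[k+1]≡[n+1]C[k+1] n k)

nCk≤[1+n]Ck : ∀ n k → n C k ≤ suc n C k
nCk≤[1+n]Ck n zero    = ℕ.≤-refl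
nCk≤[1+n]Ck n (suc k) = subst (n C suc k ≤_) (nCk+nC[k+1]≡[n+1]C[k+1] n k) (ℕ.m≤n+m _ (n C k))

nCk≤[m+n]Ck : ∀ m n k → n C k ≤ (m +ⁿ n) C k
nCk≤[m+n]Ck zero    n k = ℕ.≤-refl
nCk≤[m+n]Ck (suc m) n k = ℕ.≤-trans (nCk≤[m+n]Ck m n k) (nCk≤[1+n]Ck (m +ⁿ n) k)

C-monoˡ-≤ : ∀ k {m n} → m ≤ n → m C k ≤ n C k
C-monoˡ-≤ k {m} {n} m≤n = subst (λ x → m C k ≤ x C k) (ℕ.m∸n+n≡m m≤n) (nCk≤[m+n]Ck (n ∸ m) m k)

-- Induction on `m` by Pascal's rule: the term with lower index `k` only grows when `n` is added,
-- and the other is left to the induction hypothesis. For lower index 0 it would claim 2 ≤ 1.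
C-superadditive : ∀ m n {k} → 1 ≤ k → m C k +ⁿ n C k ≤ (m +ⁿ n) C k
C-superadditive zero    n {suc k} _    = ℕ.≤-refl
C-superadditive (suc m) n {suc k} 1≤k = begin
  suc m C suc k +ⁿ n C suc k               ≡⟨ cong (_+ⁿ n C suc k) (sym (nCk+nC[k+1]≡[n+1]C[k+1] m k)) ⟩
  m C k +ⁿ m C suc k +ⁿ n C suc k          ≡⟨ ℕ.+-assoc (m C k) _ _ ⟩
  m C k +ⁿ (m C suc k +ⁿ n C suc k)        ≤⟨ ℕ.+-mono-≤ (C-monoˡ-≤ k (ℕ.m≤m+n m n)) (C-superadditive m n 1≤k) ⟩
  (m +ⁿ n) C k +ⁿ (m +ⁿ n) C suc k         ≡⟨ nCk+nC[k+1]≡[n+1]C[k+1] (m +ⁿ n) k ⟩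
  suc (m +ⁿ n) C suc k                     ∎
  where open ℕ.≤-Reasoning

-- Passing from d to d + 1 lowers the three shifted binomials by C(a + b − d − 1, k),
-- C(a − d − 1, k) and C(b − d − 1, k), and the first dominates the sum of the others.
C-shift : ∀ a b d {k} → 1 ≤ k →
          (a +ⁿ b ∸ d) C suc k +ⁿ (a C suc k +ⁿ b C suc k) ≤
          (a +ⁿ b) C suc k +ⁿ ((a ∸ d) C suc k +ⁿ (b ∸ d) C suc k)
C-shift a b zero        1≤k = ℕ.≤-refl
C-shift a b (suc d) {k} 1≤k = ℕ.+-cancelˡ-≤ (m C k) _ _ (begin
  m C k +ⁿ (m C suc k +ⁿ c)              ≡⟨ sym (ℕ.+-assoc (m C k) _ _) ⟩
  m C k +ⁿ m C suc k +ⁿ c                ≡⟨ cong (_+ⁿ c) (lower (a +ⁿ b)) ⟨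
  (a +ⁿ b ∸ d) C suc k +ⁿ c              ≤⟨ C-shift a b d 1≤k ⟩
  s +ⁿ ((a ∸ d) C suc k +ⁿ (b ∸ d) C suc k)
                                         ≡⟨ cong (s +ⁿ_) (cong₂ _+ⁿ_ (lower a) (lower b)) ⟩
  s +ⁿ (p C k +ⁿ p C suc k +ⁿ (q C k +ⁿ q C suc k))
                                         ≡⟨ rearrange s (p C k) (p C suc k) (q C k) (q C suc k) ⟩
  p C k +ⁿ q C k +ⁿ (s +ⁿ (p C suc k +ⁿ q C suc k))
                                         ≤⟨ ℕ.+-monoˡ-≤ _ (ℕ.≤-trans (C-superadditive p q 1≤k) (C-monoˡ-≤ k p+q≤m)) ⟩
  m C k +ⁿ (s +ⁿ (p C suc k +ⁿ q C suc k)) ∎)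
  where
  open ℕ.≤-Reasoning
  m p q c s : ℕ
  m = a +ⁿ b ∸ suc d
  p = a ∸ suc d
  q = b ∸ suc d
  c = a C suc k +ⁿ b C suc k
  s = (a +ⁿ b) C suc k
  lower : ∀ x → (x ∸ d) C suc k ≡ (x ∸ suc d) C k +ⁿ (x ∸ suc d) C suc k
  lower x = subst (λ y → (x ∸ d) C suc k ≡ y C k +ⁿ y C suc k) (ℕ.pred[m∸n]≡m∸[1+n] x d)
                  (nC[1+k]≡pred (x ∸ d) 1≤k)
  rearrange : ∀ s x x′ y y′ → s +ⁿ (x +ⁿ x′ +ⁿ (y +ⁿ y′)) ≡ x +ⁿ y +ⁿ (s +ⁿ (x′ +ⁿ y′))
  rearrange = solve-∀
  p+q≤m : p +ⁿ q ≤ m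
  -- Truncation forces two cases. If `a` absorbs the whole shift, `q` may be raised to `b`;
  -- otherwise `p` is 0.
  p+q≤m with ℕ.≤-total (suc d) a
  ... | inj₁ d<a = begin
    p +ⁿ q            ≤⟨ ℕ.+-monoʳ-≤ p (ℕ.m∸n≤m b (suc d)) ⟩
    p +ⁿ b            ≡⟨ ℕ.+-∸-comm b d<a ⟨
    m                 ∎
  ... | inj₂ a≤d = begin
    p +ⁿ q            ≡⟨ cong (_+ⁿ q) (ℕ.m≤n⇒m∸n≡0 a≤d) ⟩
    q                 ≤⟨ ℕ.∸-monoˡ-≤ (suc d) (ℕ.m≤n+m b a) ⟩
    m                 ∎

-- Indicators and counting

∑ : List I → (I → ℕ) → ℕ
∑ xs f = sum (map f xs)

∑-mono-≤ : ∀ {f g : I → ℕ} → (∀ x → f x ≤ g x) → ∀ xs → ∑ xs f ≤ ∑ xs g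
∑-mono-≤ f≤g []       = z≤n
∑-mono-≤ f≤g (x ∷ xs) = ℕ.+-mono-≤ (f≤g x) (∑-mono-≤ f≤g xs)

∑-+ : ∀ (f g : I → ℕ) xs → ∑ xs (λ x → f x +ⁿ g x) ≡ ∑ xs f +ⁿ ∑ xs g
∑-+ f g []       = refl
∑-+ f g (x ∷ xs) = trans (cong (f x +ⁿ g x +ⁿ_) (∑-+ f g xs)) (interchange (f x) (g x) _ _)

∑-cong : ∀ {f g : I → ℕ} → (∀ x → f x ≡ g x) → ∀ xs → ∑ xs f ≡ ∑ xs g
∑-cong f≡g []       = refl
∑-cong f≡g (x ∷ xs) = cong₂ _+ⁿ_ (f≡g x) (∑-cong f≡g xs)

∑-zero : ∀ {f : I → ℕ} → (∀ x → f x ≡ 0) → ∀ xs → ∑ xs f ≡ 0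
∑-zero f≡0 []       = refl
∑-zero f≡0 (x ∷ xs) = cong₂ _+ⁿ_ (f≡0 x) (∑-zero f≡0 xs)

𝟙 : Dec P → ℕ
𝟙 p? = if does p? then 1 else 0

𝟙-yes : (p? : Dec P) → P → 𝟙 p? ≡ 1
𝟙-yes p? p = cong (if_then 1 else 0) (dec-true p? p)

𝟙-no : (p? : Dec P) → ¬ P → 𝟙 p? ≡ 0
𝟙-no (yes p) ¬p = contradiction p ¬p
𝟙-no (no _)  ¬p = refl

𝟙-mono-≤ : (p? : Dec P) (q? : Dec Q) → (P → Q) → 𝟙 p? ≤ 𝟙 q?
𝟙-mono-≤ (no _)  q? f = z≤n
𝟙-mono-≤ (yes p) q? f = ℕ.≤-reflexive (sym (𝟙-yes q? (f p)))

𝟙-cong : (p? : Dec P) (q? : Dec Q) → (P → Q) → (Q → P) → 𝟙 p? ≡ 𝟙 q?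
𝟙-cong p? q? f g = ℕ.≤-antisym (𝟙-mono-≤ p? q? f) (𝟙-mono-≤ q? p? g)

𝟙-cover : (p? : Dec P) (q? : Dec Q) (r? : Dec R) → (P → Q ⊎ R) → 𝟙 p? ≤ 𝟙 q? +ⁿ 𝟙 r?
𝟙-cover (no _)  q? r? f = z≤n
𝟙-cover (yes p) q? r? f with f p
... | inj₁ q = ℕ.≤-trans (ℕ.≤-reflexive (sym (𝟙-yes q? q))) (ℕ.m≤m+n _ _)
... | inj₂ r = ℕ.≤-trans (ℕ.≤-reflexive (sym (𝟙-yes r? r))) (ℕ.m≤n+m _ _)

𝟙-disjoint : (p? : Dec P) (q? : Dec Q) (r? : Dec R) →
             (P → R) → (Q → R) → (P → ¬ Q) → 𝟙 p? +ⁿ 𝟙 q? ≤ 𝟙 r?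
𝟙-disjoint (no _)  q?      r? f g ⊥ = 𝟙-mono-≤ q? r? g
𝟙-disjoint (yes p) (no _)  r? f g ⊥ = ℕ.≤-reflexive (sym (𝟙-yes r? (f p)))
𝟙-disjoint (yes p) (yes q) r? f g ⊥ = contradiction q (⊥ p)

length-filter≡∑ : ∀ {P : I → Set} (P? : Decidable P) xs → length (filter P? xs) ≡ ∑ xs (𝟙 ∘ P?)
length-filter≡∑ P? []       = refl
length-filter≡∑ P? (x ∷ xs) with P? x
... | yes _ = cong suc (length-filter≡∑ P? xs)
... | no  _ = length-filter≡∑ P? xs

-- Finite subsets

⟦_⟧ : {P : Fin N → Set} → Decidable P → Subset N
⟦ P? ⟧ = tabulate (does ∘ P?)

∈-⟦⟧⁺ : {P : Fin N → Set} (P? : Decidable P) → ∀ {x} → P x → x ∈ ⟦ P? ⟧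
∈-⟦⟧⁺ P? {x} px = lookup⇒[]= x _ (trans (lookup∘tabulate _ x) (dec-true (P? x) px))

∈-⟦⟧⁻ : {P : Fin N → Set} (P? : Decidable P) → ∀ {x} → x ∈ ⟦ P? ⟧ → P x
∈-⟦⟧⁻ P? {x} x∈ with P? x | trans (sym (lookup∘tabulate (does ∘ P?) x)) ([]=⇒lookup x∈)
... | yes px | _  = px
... | no _   | ()

x∈p─q⇒x∉q : ∀ (p q : Subset N) {x} → x ∈ p ─ q → x ∉ q
x∈p─q⇒x∉q (_ ∷ p) (outside ∷ q) (there x∈) (there x∈q) = x∈p─q⇒x∉q p q x∈ x∈q
x∈p─q⇒x∉q (_ ∷ p) (inside  ∷ q) (there x∈) (there x∈q) = x∈p─q⇒x∉q p q x∈ x∈q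

∣p∪q∣≡∣p∣+∣q∣ : ∀ (p q : Subset N) → (∀ {x} → x ∈ p → x ∉ q) → ∣ p ∪ q ∣ ≡ ∣ p ∣ +ⁿ ∣ q ∣
∣p∪q∣≡∣p∣+∣q∣ []            []            _  = refl
∣p∪q∣≡∣p∣+∣q∣ (outside ∷ p) (outside ∷ q) ⊥ = ∣p∪q∣≡∣p∣+∣q∣ p q (λ x∈p x∈q → ⊥ (there x∈p) (there x∈q))
∣p∪q∣≡∣p∣+∣q∣ (inside  ∷ p) (outside ∷ q) ⊥ = cong suc (∣p∪q∣≡∣p∣+∣q∣ p q (λ x∈p x∈q → ⊥ (there x∈p) (there x∈q)))
∣p∪q∣≡∣p∣+∣q∣ (outside ∷ p) (inside  ∷ q) ⊥ = trans
  (cong suc (∣p∪q∣≡∣p∣+∣q∣ p q (λ x∈p x∈q → ⊥ (there x∈p) (there x∈q)))) (sym (ℕ.+-suc _ _))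
∣p∪q∣≡∣p∣+∣q∣ (inside  ∷ p) (inside  ∷ q) ⊥ = contradiction here (⊥ here)

Block : ℕ → Subset N → Subset N → Set
Block r W S = S ⊆ W × ∣ S ∣ ≡ r

block? : ∀ r (W : Subset N) → Decidable (Block r W)
block? r W S = (S ⊆? W) ×-dec (∣ S ∣ ℕ.≟ r)

-- Induction on the ambient size, splitting the sum by whether `S` contains the first point. If that
-- point is in `W`, the two halves are the two terms of Pascal's rule; if not, the sets containing
-- it contribute nothing.
∑-block : ∀ (W : Subset N) r → ∑ (subsets N) (𝟙 ∘ block? r W) ≡ ∣ W ∣ C r
∑-block []              zero    = cong (_+ⁿ 0) (𝟙-yes (block? 0 [] []) (id , refl))
∑-block []              (suc r) = cong (_+ⁿ 0) (𝟙-no (block? (suc r) [] []) λ ())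
∑-block {suc N} (w ∷ W) r       = begin
  ∑ (map (inside ∷_) (subsets N) ++ map (outside ∷_) (subsets N)) f
    ≡⟨ cong sum (map-++ f (map (inside ∷_) (subsets N)) _) ⟩
  sum (map f (map (inside ∷_) (subsets N)) ++ map f (map (outside ∷_) (subsets N)))
    ≡⟨ sum-++ (map f (map (inside ∷_) (subsets N))) _ ⟩
  ∑ (map (inside ∷_) (subsets N)) f +ⁿ ∑ (map (outside ∷_) (subsets N)) f
    ≡⟨ cong₂ (λ xs ys → sum xs +ⁿ sum ys) (map-∘ (subsets N)) (map-∘ (subsets N)) ⟨
  ∑ (subsets N) (f ∘ (inside ∷_)) +ⁿ ∑ (subsets N) (f ∘ (outside ∷_))
    ≡⟨ cong (∑ (subsets N) (f ∘ (inside ∷_)) +ⁿ_) (trans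
         (∑-cong (λ S → 𝟙-cong (block? r (w ∷ W) (outside ∷ S)) (block? r W S)
           (λ (S⊆ , eq) → (λ {x} → drop-∷-⊆ S⊆ {x}) , eq) (λ (S⊆ , eq) → (λ {x} → out⊆ S⊆ {x}) , eq)) (subsets N))
         (∑-block W r)) ⟩
  ∑ (subsets N) (f ∘ (inside ∷_)) +ⁿ ∣ W ∣ C r
    ≡⟨ split w r ⟩
  ∣ w ∷ W ∣ C r ∎
  where
  open ≡-Reasoning
  f : Subset (suc N) → ℕ
  f = 𝟙 ∘ block? r (w ∷ W)
  split : ∀ w r → ∑ (subsets N) (λ S → 𝟙 (block? r (w ∷ W) (inside ∷ S))) +ⁿ ∣ W ∣ C r ≡ ∣ w ∷ W ∣ C r
  split outside r       = cong (_+ⁿ ∣ W ∣ C r)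
    (∑-zero (λ S → 𝟙-no (block? r (outside ∷ W) (inside ∷ S)) λ (S⊆ , _) → contradiction (S⊆ here) λ ()) (subsets N))
  split inside  zero    = cong (_+ⁿ ∣ W ∣ C zero)
    (∑-zero (λ S → 𝟙-no (block? zero (inside ∷ W) (inside ∷ S)) λ ()) (subsets N))
  split inside  (suc r) = trans
    (cong (_+ⁿ ∣ W ∣ C suc r) (trans
      (∑-cong (λ S → 𝟙-cong (block? (suc r) (inside ∷ W) (inside ∷ S)) (block? r W S)
        (λ (S⊆ , eq) → (λ {x} → drop-∷-⊆ S⊆ {x}) , ℕ.suc-injective eq)
        (λ (S⊆ , eq) → (λ {x} → in⊆in S⊆ {x}) , cong suc eq)) (subsets N))
      (∑-block W r)))
    (nCk+nC[k+1]≡[n+1]C[k+1] ∣ W ∣ r)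

-- Paths and separations

path-from-vertex : ∀ (H : Hypergraph N) {u v x xs es} →
                   Walk H u v xs es → Unique xs → Unique es → x ∈ₗ xs → Path H x v
path-from-vertex H (stop v∈) uxs ues (here refl) = record
  { walk = stop v∈ ; vertices-distinct = uxs ; edges-distinct = ues }
path-from-vertex H (step e∈ u∈ w∈ π) uxs ues (here refl) = record
  { walk = step e∈ u∈ w∈ π ; vertices-distinct = uxs ; edges-distinct = ues }
path-from-vertex H (step _ _ _ π) (_ ∷ uxs) (_ ∷ ues) (there x∈) = path-from-vertex H π uxs ues x∈

-- The part of the path up to and including the entry to `e` is replaced by a single step from `x`
-- through `e`. What remains keeps its vertices and edges distinct.
path-from-edge : ∀ (H : Hypergraph N) {u v x e xs es} →
                 Walk H u v xs es → Unique xs → Unique es → e ∈ₗ es → x ∈ e → x ∉ₗ xs → Path H x v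
path-from-edge H (step e∈ _ w∈ π) (_ ∷ uxs) ues (here refl) x∈ x∉ = record
  { walk = step e∈ x∈ w∈ π ; vertices-distinct = All.¬Any⇒All¬ _ (x∉ ∘ there) ∷ uxs ; edges-distinct = ues }
path-from-edge H (step _ _ _ π) (_ ∷ uxs) (_ ∷ ues) (there e∈) x∈ x∉ =
  path-from-edge H π uxs ues e∈ x∈ (x∉ ∘ there)

-- Prepending naively may repeat `x` or `e`. If `x` is already on the path, its suffix from `x`
-- serves; if only `e` is, the path is entered at `e`.
path-prepend : ∀ (H : Hypergraph N) {u v x e} → e ∈ₗ E H → x ∈ e → u ∈ e → Path H u v → Path H x v
path-prepend H {x = x} {e} e∈ x∈ u∈ p
  with DecMembership._∈?_ _≟ᶠ_ x (Path.vertices p) | e ∈ₗ? Path.edges p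
... | yes x∈xs | _        = path-from-vertex H walk vertices-distinct edges-distinct x∈xs
  where open Path p
... | no  x∉xs | yes e∈es = path-from-edge H walk vertices-distinct edges-distinct e∈es x∈ x∉xs
  where open Path p
... | no  x∉xs | no  e∉es = record
  { walk              = step e∈ x∈ u∈ walk
  ; vertices-distinct = All.¬Any⇒All¬ _ x∉xs ∷ vertices-distinct
  ; edges-distinct    = All.¬Any⇒All¬ _ e∉es ∷ edges-distinct
  }
  where open Path p

record Disconnection (H : Hypergraph N) : Set where
  field
    A B        : Subset N
    A⊆V        : A ⊆ V H
    B⊆V        : B ⊆ V H
    V⊆A∪B      : V H ⊆ A ∪ B
    A∩B        : ∀ {x} → x ∈ A → x ∉ B
    A-nonempty : Nonempty A
    B-nonempty : Nonempty B
    uncrossed  : ∀ {e} → e ∈ₗ E H → e ⊆ A ⊎ e ⊆ B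

-- `A` collects the vertices with a path to `v`, and `B` the remaining ones, among them `u`. The
-- endpoint `v` is kept fixed because `path-prepend` extends paths at their start.
disconnection : (H : Hypergraph N) → ∀ {u v} → u ∈ V H → v ∈ V H → ¬ Path H u v → Disconnection H
disconnection H {u} {v} u∈ v∈ ¬path = record
  { A          = ⟦ near? ⟧
  ; B          = ⟦ far? ⟧
  ; A⊆V        = λ x∈ → proj₁ (∈-⟦⟧⁻ near? x∈)
  ; B⊆V        = λ x∈ → proj₁ (∈-⟦⟧⁻ far? x∈)
  ; V⊆A∪B      = λ {x} x∈ → x∈p∪q⁺ ([ (λ p → inj₁ (∈-⟦⟧⁺ near? (x∈ , p))) , (λ ¬p → inj₂ (∈-⟦⟧⁺ far? (x∈ , ¬p))) ]′
                                    (toSum (path? H x v)))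
  ; A∩B        = λ x∈A x∈B → proj₂ (∈-⟦⟧⁻ far? x∈B) (proj₂ (∈-⟦⟧⁻ near? x∈A))
  ; A-nonempty = v , ∈-⟦⟧⁺ near? (v∈ , record { walk = stop v∈ ; vertices-distinct = [] ∷ [] ; edges-distinct = [] })
  ; B-nonempty = u , ∈-⟦⟧⁺ far? (u∈ , ¬path)
  ; uncrossed  = λ e∈ → uncrossed e∈ (nonempty H e∈)
  }
  where
  near? : Decidable (λ x → x ∈ V H × Path H x v)
  near? x = (x ∈? V H) ×-dec path? H x v
  far? : Decidable (λ x → x ∈ V H × ¬ Path H x v)
  far? x = (x ∈? V H) ×-dec ¬? (path? H x v)
  uncrossed : ∀ {e} → e ∈ₗ E H → Nonempty e → e ⊆ ⟦ near? ⟧ ⊎ e ⊆ ⟦ far? ⟧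
  -- One vertex of the edge decides the side: a path from any of its vertices gives a path from each
  -- of the others.
  uncrossed e∈ (x , x∈e) with path? H x v
  ... | yes p = inj₁ λ y∈e → ∈-⟦⟧⁺ near? (edge⊆V H e∈ y∈e , path-prepend H e∈ y∈e x∈e p)
  ... | no ¬p = inj₂ λ y∈e → ∈-⟦⟧⁺ far? (edge⊆V H e∈ y∈e , λ p → ¬p (path-prepend H e∈ x∈e y∈e p))

disconnected : (H : Hypergraph N) → ¬ Connected H → Disconnection H
disconnected {N} H ¬conn
  with ¬∀⟶∃¬ N _ (λ u → all? λ v → (u ∈? V H) →-dec ((v ∈? V H) →-dec path? H u v)) ¬conn
... | u , ¬u with ¬∀⟶∃¬ N _ (λ v → (u ∈? V H) →-dec ((v ∈? V H) →-dec path? H u v)) ¬u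
... | v , ¬uv = disconnection H {u} {v}
  -- For `u` outside `V H` the refuted implication would hold vacuously; the same goes for `v`.
  (decidable-stable (u ∈? V H) (λ u∉ → ¬uv λ u∈ → contradiction u∈ u∉))
  (decidable-stable (v ∈? V H) (λ v∉ → ¬uv λ _ v∈ → contradiction v∈ v∉))
  (λ p → ¬uv λ _ _ → p)

-- A cut of the subhypergraph induced on `W`, expressed through `H` itself. Only edges inside
-- `A ∪ B` are confined to one side, as an edge meeting `X` may reach both.
record Separation (k : ℕ) (H : Hypergraph N) (W : Subset N) : Set where
  field
    A B X      : Subset N
    A⊆W        : A ⊆ W
    B⊆W        : B ⊆ W
    X⊆W        : X ⊆ W
    W⊆         : W ⊆ (A ∪ B) ∪ X
    A∩B        : ∀ {x} → x ∈ A → x ∉ B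
    A∩X        : ∀ {x} → x ∈ A → x ∉ X
    B∩X        : ∀ {x} → x ∈ B → x ∉ X
    A-nonempty : Nonempty A
    B-nonempty : Nonempty B
    ∣X∣≤k      : ∣ X ∣ ≤ k
    uncrossed  : ∀ {e} → e ∈ₗ E H → e ⊆ A ∪ B → e ⊆ A ⊎ e ⊆ B

  A∪B⊆W : A ∪ B ⊆ W
  A∪B⊆W x∈ = [ A⊆W , B⊆W ]′ (x∈p∪q⁻ A B x∈)

  A∪X⊆W : A ∪ X ⊆ W
  A∪X⊆W x∈ = [ A⊆W , X⊆W ]′ (x∈p∪q⁻ A X x∈)

  B∪X⊆W : B ∪ X ⊆ W
  B∪X⊆W x∈ = [ B⊆W , X⊆W ]′ (x∈p∪q⁻ B X x∈)

  ∣A∪X∣<∣W∣ : ∣ A ∪ X ∣ < ∣ W ∣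
  ∣A∪X∣<∣W∣ =
    let x , x∈B = B-nonempty
    in p⊂q⇒∣p∣<∣q∣ (A∪X⊆W , x , B⊆W x∈B , λ x∈ → [ (λ x∈A → A∩B x∈A x∈B) , B∩X x∈B ]′ (x∈p∪q⁻ A X x∈))

  ∣B∪X∣<∣W∣ : ∣ B ∪ X ∣ < ∣ W ∣
  ∣B∪X∣<∣W∣ =
    let x , x∈A = A-nonempty
    in p⊂q⇒∣p∣<∣q∣ (B∪X⊆W , x , A⊆W x∈A , λ x∈ → [ A∩B x∈A , A∩X x∈A ]′ (x∈p∪q⁻ B X x∈))

  ∣A∪B∣≡∣A∣+∣B∣ : ∣ A ∪ B ∣ ≡ ∣ A ∣ +ⁿ ∣ B ∣
  ∣A∪B∣≡∣A∣+∣B∣ = ∣p∪q∣≡∣p∣+∣q∣ A B A∩B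

  private
    -- Cancelling `∣ X ∣` turns subtraction of `k` into subtraction of `k ∸ ∣ X ∣`. The sets
    -- `A ∪ X`, `B ∪ X` and `W` thus all get the same shift, as `C-shift` requires.
    ∸-∸ : ∀ {y z} → z ≡ y +ⁿ ∣ X ∣ → z ∸ k ≡ y ∸ (k ∸ ∣ X ∣)
    ∸-∸ {y} {z} eq = begin
      z ∸ k                                 ≡⟨ cong₂ _∸_ (trans eq (ℕ.+-comm y (∣ X ∣))) (sym (ℕ.m+[n∸m]≡n ∣X∣≤k)) ⟩
      (∣ X ∣ +ⁿ y) ∸ (∣ X ∣ +ⁿ (k ∸ ∣ X ∣))  ≡⟨ ℕ.[m+n]∸[m+o]≡n∸o (∣ X ∣) y (k ∸ ∣ X ∣) ⟩
      y ∸ (k ∸ ∣ X ∣)                       ∎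
      where open ≡-Reasoning

  ∣A∪X∣∸k≡ : ∣ A ∪ X ∣ ∸ k ≡ ∣ A ∣ ∸ (k ∸ ∣ X ∣)
  ∣A∪X∣∸k≡ = ∸-∸ (∣p∪q∣≡∣p∣+∣q∣ A X A∩X)

  ∣B∪X∣∸k≡ : ∣ B ∪ X ∣ ∸ k ≡ ∣ B ∣ ∸ (k ∸ ∣ X ∣)
  ∣B∪X∣∸k≡ = ∸-∸ (∣p∪q∣≡∣p∣+∣q∣ B X B∩X)

  ∣W∣∸k≡ : ∣ W ∣ ∸ k ≡ ∣ A ∣ +ⁿ ∣ B ∣ ∸ (k ∸ ∣ X ∣)
  ∣W∣∸k≡ = ∸-∸ (begin
    ∣ W ∣                    ≡⟨ cong ∣_∣ (⊆-antisym W⊆ λ x∈ → [ A∪B⊆W , X⊆W ]′ (x∈p∪q⁻ (A ∪ B) X x∈)) ⟩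
    ∣ (A ∪ B) ∪ X ∣          ≡⟨ ∣p∪q∣≡∣p∣+∣q∣ (A ∪ B) X (λ x∈ → [ A∩X , B∩X ]′ (x∈p∪q⁻ A B x∈)) ⟩
    ∣ A ∪ B ∣ +ⁿ ∣ X ∣       ≡⟨ cong (_+ⁿ ∣ X ∣) ∣A∪B∣≡∣A∣+∣B∣ ⟩
    ∣ A ∣ +ⁿ ∣ B ∣ +ⁿ ∣ X ∣  ∎)
    where open ≡-Reasoning

-- Without a vertex-cut, `κ H` would take its default value `order H ∸ 1`, which exceeds `k`. So
-- cuts exist, and one attaining `κ H` is small enough.
small-cut : (H : Hypergraph N) → ∀ {k} → κ H ≤ k → k < order H ∸ 1 → ∃ λ X → VertexCut H X × ∣ X ∣ ≤ k
small-cut {N} H {k} κ≤k k< = [ cut , (λ ¬cut → contradiction κ≤k (ℕ.<⇒≱ (uncut ¬cut))) ]′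
  (toSum (Any.any? (vertexCut? H) (subsets N)))
  where
  uncut : ¬ Any.Any (VertexCut H) (subsets N) → k < κ H
  uncut ¬cut = subst (k <_) (sym (κ-uncut H λ (X , X-cut) →
    ¬cut (Any.map (λ eq → subst (VertexCut H) eq X-cut) (∈-subsets X)))) k<
  cut : Any.Any (VertexCut H) (subsets N) → ∃ λ X → VertexCut H X × ∣ X ∣ ≤ k
  cut any = let X , X-cut , eq = κ-attained H (Any.satisfied any) in X , X-cut , subst (_≤ k) eq κ≤k

separation : ∀ (H : Hypergraph N) {k W X} → X ⊆ W → ∣ X ∣ ≤ k →
             Disconnection (sub H W (E H) − X) → Separation k H W
separation H {W = W} {X} X⊆W ∣X∣≤k δ = record
  { A          = A
  ; B          = B
  ; X          = X
  ; A⊆W        = λ x∈ → p─q⊆p W X (A⊆V x∈)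
  ; B⊆W        = λ x∈ → p─q⊆p W X (B⊆V x∈)
  ; X⊆W        = X⊆W
  ; W⊆         = cover
  ; A∩B        = A∩B
  ; A∩X        = λ x∈ → x∈p─q⇒x∉q W X (A⊆V x∈)
  ; B∩X        = λ x∈ → x∈p─q⇒x∉q W X (B⊆V x∈)
  ; A-nonempty = A-nonempty
  ; B-nonempty = B-nonempty
  ; ∣X∣≤k      = ∣X∣≤k
  ; uncrossed  = λ e∈ e⊆ → uncrossed (inside-cut e∈ λ x∈ → [ A⊆V , B⊆V ]′ (x∈p∪q⁻ A B (e⊆ x∈)))
  }
  where
  open Disconnection δ
  cover : W ⊆ (A ∪ B) ∪ X
  cover {x} x∈W with x ∈? X
  ... | yes x∈X = x∈p∪q⁺ (inj₂ x∈X)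
  ... | no  x∉X = x∈p∪q⁺ (inj₁ (V⊆A∪B (x∈p∧x∉q⇒x∈p─q x∈W x∉X)))
  inside-cut : ∀ {e} → e ∈ₗ E H → e ⊆ W ─ X → e ∈ₗ E (sub H W (E H) − X)
  inside-cut e∈ e⊆ = ∈-filter⁺ (_⊆? (W ─ X))
    (∈-filter⁺ (subEdge? W (E H)) e∈ (e∈ , λ x∈ → p─q⊆p W X (e⊆ x∈))) e⊆

-- Since `κ̄` bounds `κ` of every subhypergraph, it bounds that of the one induced on `W`, here
-- `sub H W (E H)`. Hence every large enough `W` can be split, not just `V H`.
separate : ∀ (H : Hypergraph N) {k W} → κ̄ H ≤ k → W ⊆ V H → k < ∣ W ∣ ∸ 1 → Separation k H W
separate H {W = W} κ̄≤k W⊆V k< =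
  let K = sub H W (E H)
      K⊑H : K ⊑ H
      K⊑H = W⊆V , λ e∈ → proj₁ (∈-filter⁻ (subEdge? W (E H)) {xs = E H} e∈)
      X , (X⊆W , ¬conn) , ∣X∣≤k = small-cut K (ℕ.≤-trans (κ̄-upper H K K⊑H) κ̄≤k) k<
  in separation H X⊆W ∣X∣≤k (disconnected (K − X) ¬conn)

-- Non-edges

-- Taken relative to `W`, so that the induction can shrink `W` while `H` stays fixed.
NonEdge : ℕ → Hypergraph N → Subset N → Subset N → Set
NonEdge r H W S = Block r W S × S ∉ₗ E H

nonEdge? : ∀ r (H : Hypergraph N) W → Decidable (NonEdge r H W)
nonEdge? r H W S = block? r W S ×-dec ¬? (S ∈ₗ? E H)

nonEdges : ℕ → Hypergraph N → Subset N → ℕ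
nonEdges {N} r H W = ∑ (subsets N) (𝟙 ∘ nonEdge? r H W)

-- The blocks of `A ∪ B` meeting both sides number `∣ A ∪ B ∣ C r` less `∣ A ∣ C r` and `∣ B ∣ C r`;
-- the subtracted terms stand on the right to stay within ℕ. The inequality is proved for the
-- indicators at each `S` and then summed.
nonEdges-separation : ∀ {r k} (H : Hypergraph N) {W} → k < r → (σ : Separation k H W) → let open Separation σ in
  ∣ A ∪ B ∣ C r +ⁿ (nonEdges r H (A ∪ X) +ⁿ nonEdges r H (B ∪ X)) ≤
  nonEdges r H W +ⁿ (∣ A ∣ C r +ⁿ ∣ B ∣ C r)
nonEdges-separation {N} {r} {k} H {W} k<r σ = begin
  ∣ A ∪ B ∣ C r +ⁿ (nonEdges r H (A ∪ X) +ⁿ nonEdges r H (B ∪ X))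
    ≡⟨ cong (_+ⁿ (nonEdges r H (A ∪ X) +ⁿ nonEdges r H (B ∪ X))) (∑-block (A ∪ B) r) ⟨
  ∑ (subsets N) ab +ⁿ (∑ (subsets N) n₁ +ⁿ ∑ (subsets N) n₂)
    ≡⟨ cong (∑ (subsets N) ab +ⁿ_) (∑-+ n₁ n₂ (subsets N)) ⟨
  ∑ (subsets N) ab +ⁿ ∑ (subsets N) (λ S → n₁ S +ⁿ n₂ S)
    ≡⟨ ∑-+ ab _ (subsets N) ⟨
  ∑ (subsets N) (λ S → ab S +ⁿ (n₁ S +ⁿ n₂ S))
    ≤⟨ ∑-mono-≤ pointwise (subsets N) ⟩
  ∑ (subsets N) (λ S → n₀ S +ⁿ (a S +ⁿ b S))
    ≡⟨ ∑-+ n₀ _ (subsets N) ⟩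
  ∑ (subsets N) n₀ +ⁿ ∑ (subsets N) (λ S → a S +ⁿ b S)
    ≡⟨ cong (∑ (subsets N) n₀ +ⁿ_) (∑-+ a b (subsets N)) ⟩
  ∑ (subsets N) n₀ +ⁿ (∑ (subsets N) a +ⁿ ∑ (subsets N) b)
    ≡⟨ cong (∑ (subsets N) n₀ +ⁿ_) (cong₂ _+ⁿ_ (∑-block A r) (∑-block B r)) ⟩
  nonEdges r H W +ⁿ (∣ A ∣ C r +ⁿ ∣ B ∣ C r) ∎
  where
  open Separation σ
  open ℕ.≤-Reasoning
  ab a b n₀ n₁ n₂ : Subset N → ℕ
  ab = 𝟙 ∘ block? r (A ∪ B)
  a  = 𝟙 ∘ block? r A
  b  = 𝟙 ∘ block? r B
  n₀ = 𝟙 ∘ nonEdge? r H W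
  n₁ = 𝟙 ∘ nonEdge? r H (A ∪ X)
  n₂ = 𝟙 ∘ nonEdge? r H (B ∪ X)
  Crossing : Subset N → Set
  Crossing S = Block r (A ∪ B) S × ¬ (S ⊆ A) × ¬ (S ⊆ B)
  crossing? : Decidable Crossing
  crossing? S = block? r (A ∪ B) S ×-dec ¬? (S ⊆? A) ×-dec ¬? (S ⊆? B)
  parts : ∀ S → Block r (A ∪ B) S → Crossing S ⊎ (Block r A S ⊎ Block r B S)
  parts S (S⊆ , eq) with S ⊆? A | S ⊆? B
  ... | yes S⊆A | _       = inj₂ (inj₁ ((λ {x} → S⊆A {x}) , eq))
  ... | no _    | yes S⊆B = inj₂ (inj₂ ((λ {x} → S⊆B {x}) , eq))
  ... | no S⊈A  | no S⊈B  = inj₁ (((λ {x} → S⊆ {x}) , eq) , S⊈A , S⊈B)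
  [A∪B]∩[A∪X]⊆A : ∀ {x} → x ∈ A ∪ B → x ∈ A ∪ X → x ∈ A
  [A∪B]∩[A∪X]⊆A x∈ x∈′ with x∈p∪q⁻ A B x∈ | x∈p∪q⁻ A X x∈′
  ... | inj₁ x∈A | _        = x∈A
  ... | inj₂ _   | inj₁ x∈A = x∈A
  ... | inj₂ x∈B | inj₂ x∈X = contradiction x∈X (B∩X x∈B)
  [A∪B]∩[B∪X]⊆B : ∀ {x} → x ∈ A ∪ B → x ∈ B ∪ X → x ∈ B
  [A∪B]∩[B∪X]⊆B x∈ x∈′ with x∈p∪q⁻ A B x∈ | x∈p∪q⁻ B X x∈′
  ... | inj₂ x∈B | _        = x∈B
  ... | inj₁ _   | inj₁ x∈B = x∈B
  ... | inj₁ x∈A | inj₂ x∈X = contradiction x∈X (A∩X x∈A)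
  [A∪X]∩[B∪X]⊆X : ∀ {x} → x ∈ A ∪ X → x ∈ B ∪ X → x ∈ X
  [A∪X]∩[B∪X]⊆X x∈ x∈′ with x∈p∪q⁻ A X x∈ | x∈p∪q⁻ B X x∈′
  ... | inj₂ x∈X | _        = x∈X
  ... | inj₁ _   | inj₂ x∈X = x∈X
  ... | inj₁ x∈A | inj₁ x∈B = contradiction x∈B (A∩B x∈A)
  crossing⇒nonEdge : ∀ {S} → Crossing S → NonEdge r H W S
  crossing⇒nonEdge ((S⊆ , eq) , S⊈A , S⊈B) =
    ((λ x∈ → A∪B⊆W (S⊆ x∈)) , eq) , λ S∈ → [ S⊈A , S⊈B ]′ (uncrossed S∈ S⊆)
  crossing-outside : ∀ {S} → Crossing S → ¬ (NonEdge r H (A ∪ X) S ⊎ NonEdge r H (B ∪ X) S)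
  crossing-outside ((S⊆ , _) , S⊈A , _) (inj₁ ((S⊆′ , _) , _)) = S⊈A λ x∈ → [A∪B]∩[A∪X]⊆A (S⊆ x∈) (S⊆′ x∈)
  crossing-outside ((S⊆ , _) , _ , S⊈B) (inj₂ ((S⊆′ , _) , _)) = S⊈B λ x∈ → [A∪B]∩[B∪X]⊆B (S⊆ x∈) (S⊆′ x∈)
  sides-disjoint : ∀ {S} → NonEdge r H (A ∪ X) S → ¬ NonEdge r H (B ∪ X) S
  sides-disjoint {S} ((S⊆ , eq) , _) ((S⊆′ , _) , _) = ℕ.<⇒≱ k<r
    (subst (_≤ k) eq (ℕ.≤-trans (p⊆q⇒∣p∣≤∣q∣ {p = S} λ x∈ → [A∪X]∩[B∪X]⊆X (S⊆ x∈) (S⊆′ x∈)) ∣X∣≤k))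
  sides⇒nonEdge : ∀ {S} → NonEdge r H (A ∪ X) S ⊎ NonEdge r H (B ∪ X) S → NonEdge r H W S
  sides⇒nonEdge (inj₁ ((S⊆ , eq) , S∉)) = ((λ x∈ → A∪X⊆W (S⊆ x∈)) , eq) , S∉
  sides⇒nonEdge (inj₂ ((S⊆ , eq) , S∉)) = ((λ x∈ → B∪X⊆W (S⊆ x∈)) , eq) , S∉
  pointwise : ∀ S → ab S +ⁿ (n₁ S +ⁿ n₂ S) ≤ n₀ S +ⁿ (a S +ⁿ b S)
  pointwise S = begin
    ab S +ⁿ (n₁ S +ⁿ n₂ S)
      -- A block of `A ∪ B` crosses or lies in `A` or in `B`, and `S` is a non-edge of at most one
      -- of the two sides.
      ≤⟨ ℕ.+-mono-≤
           (ℕ.≤-trans (𝟙-cover (block? r (A ∪ B) S) (crossing? S) eitherBlock? (parts S))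
             (ℕ.+-monoʳ-≤ (𝟙 (crossing? S)) (𝟙-cover eitherBlock? (block? r A S) (block? r B S) id)))
           (𝟙-disjoint (nonEdge? r H (A ∪ X) S) (nonEdge? r H (B ∪ X) S) eitherSide? inj₁ inj₂ sides-disjoint) ⟩
    𝟙 (crossing? S) +ⁿ (a S +ⁿ b S) +ⁿ 𝟙 eitherSide?
      ≡⟨ swap (𝟙 (crossing? S)) (a S +ⁿ b S) (𝟙 eitherSide?) ⟩
    𝟙 (crossing? S) +ⁿ 𝟙 eitherSide? +ⁿ (a S +ⁿ b S)
      -- Crossing sets and non-edges of a side are mutually exclusive kinds of non-edges of `W`, so
      -- together they count at most once.
      ≤⟨ ℕ.+-monoˡ-≤ (a S +ⁿ b S)
           (𝟙-disjoint (crossing? S) eitherSide? (nonEdge? r H W S) crossing⇒nonEdge sides⇒nonEdge crossing-outside) ⟩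
    n₀ S +ⁿ (a S +ⁿ b S) ∎
    where
    eitherBlock? : Dec (Block r A S ⊎ Block r B S)
    eitherBlock? = block? r A S ⊎-dec block? r B S
    eitherSide? : Dec (NonEdge r H (A ∪ X) S ⊎ NonEdge r H (B ∪ X) S)
    eitherSide? = nonEdge? r H (A ∪ X) S ⊎-dec nonEdge? r H (B ∪ X) S
    swap : ∀ x y z → x +ⁿ y +ⁿ z ≡ x +ⁿ z +ⁿ y
    swap = solve-∀

-- `C-shift` with `d = k ∸ ∣ X ∣` is the numerical counterpart of `nonEdges-separation`: chaining
-- the two leaves `∣ A ∣ C r +ⁿ ∣ B ∣ C r` on both sides, to be cancelled. Its condition `1 ≤ k` on
-- the lower index is where `2 ≤ r` enters.
nonEdges-glue : ∀ {r k} (H : Hypergraph N) {W} → 2 ≤ r → k < r → (σ : Separation k H W) → let open Separation σ in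
  (∣ A ∪ X ∣ ∸ k) C r ≤ nonEdges r H (A ∪ X) →
  (∣ B ∪ X ∣ ∸ k) C r ≤ nonEdges r H (B ∪ X) →
  (∣ W ∣ ∸ k) C r ≤ nonEdges r H W
nonEdges-glue {r = r@(suc s)} {k} H {W} (s≤s 1≤s) k<r σ ≤A∪X ≤B∪X = ℕ.+-cancelʳ-≤ (∣ A ∣ C r +ⁿ ∣ B ∣ C r) _ _ (begin
  (∣ W ∣ ∸ k) C r +ⁿ (∣ A ∣ C r +ⁿ ∣ B ∣ C r)
    ≡⟨ cong (λ m → m C r +ⁿ (∣ A ∣ C r +ⁿ ∣ B ∣ C r)) ∣W∣∸k≡ ⟩
  (∣ A ∣ +ⁿ ∣ B ∣ ∸ (k ∸ ∣ X ∣)) C r +ⁿ (∣ A ∣ C r +ⁿ ∣ B ∣ C r)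
    ≤⟨ C-shift (∣ A ∣) (∣ B ∣) (k ∸ ∣ X ∣) 1≤s ⟩
  (∣ A ∣ +ⁿ ∣ B ∣) C r +ⁿ ((∣ A ∣ ∸ (k ∸ ∣ X ∣)) C r +ⁿ (∣ B ∣ ∸ (k ∸ ∣ X ∣)) C r)
    ≡⟨ cong₂ _+ⁿ_ (cong (_C r) ∣A∪B∣≡∣A∣+∣B∣) (cong₂ (λ x y → x C r +ⁿ y C r) ∣A∪X∣∸k≡ ∣B∪X∣∸k≡) ⟨
  ∣ A ∪ B ∣ C r +ⁿ ((∣ A ∪ X ∣ ∸ k) C r +ⁿ (∣ B ∪ X ∣ ∸ k) C r)
    ≤⟨ ℕ.+-monoʳ-≤ (∣ A ∪ B ∣ C r) (ℕ.+-mono-≤ ≤A∪X ≤B∪X) ⟩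
  ∣ A ∪ B ∣ C r +ⁿ (nonEdges r H (A ∪ X) +ⁿ nonEdges r H (B ∪ X))
    ≤⟨ nonEdges-separation H k<r σ ⟩
  nonEdges r H W +ⁿ (∣ A ∣ C r +ⁿ ∣ B ∣ C r) ∎)
  where
  open ℕ.≤-Reasoning
  open Separation σ

nonEdges-lower : ∀ {r k} (H : Hypergraph N) → 2 ≤ r → k < r → κ̄ H ≤ k →
                 ∀ W → W ⊆ V H → Acc _<_ ∣ W ∣ → (∣ W ∣ ∸ k) C r ≤ nonEdges r H W
nonEdges-lower {r = r@(suc _)} {k} H 2≤r k<r κ̄≤k W W⊆V (acc rec) =
  -- Below the threshold `k +ⁿ r` the upper index `∣ W ∣ ∸ k` is less than `r`, so the binomial
  -- vanishes. From it on, `2 ≤ r` makes `W` large enough for `separate`.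
  [ (λ large → glue (separate H κ̄≤k W⊆V (k<∣W∣∸1 large)))
  , (λ small → subst (_≤ nonEdges r H W) (sym (k>n⇒nCk≡0 (ℕ.m<n+o⇒m∸n<o ∣ W ∣ k small))) z≤n)
  ]′ (ℕ.≤-<-connex (k +ⁿ r) ∣ W ∣)
  where
  open ℕ.≤-Reasoning
  k<∣W∣∸1 : k +ⁿ r ≤ ∣ W ∣ → k < ∣ W ∣ ∸ 1
  k<∣W∣∸1 large = ℕ.m+n≤o⇒m≤o∸n (suc k) (begin
    suc k +ⁿ 1 ≡⟨ ℕ.+-suc k 1 ⟨
    k +ⁿ 2     ≤⟨ ℕ.+-monoʳ-≤ k 2≤r ⟩
    k +ⁿ r     ≤⟨ large ⟩
    ∣ W ∣      ∎)
  glue : Separation k H W → (∣ W ∣ ∸ k) C r ≤ nonEdges r H W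
  glue σ = nonEdges-glue H 2≤r k<r σ
    (nonEdges-lower H 2≤r k<r κ̄≤k (A ∪ X) (λ x∈ → W⊆V (A∪X⊆W x∈)) (rec ∣A∪X∣<∣W∣))
    (nonEdges-lower H 2≤r k<r κ̄≤k (B ∪ X) (λ x∈ → W⊆V (B∪X⊆W x∈)) (rec ∣B∪X∣<∣W∣))
    where open Separation σ

-- Edges and non-edges are disjoint families of `r`-subsets of `V H`. Distinctness of the edge list
-- lets its length be bounded by a count over all subsets.
size+nonEdges : ∀ {r} (H : Hypergraph N) → Uniform r H → size H +ⁿ nonEdges r H (V H) ≤ order H C r
size+nonEdges {N} {r} H uniform = begin
  size H +ⁿ nonEdges r H (V H)
    ≤⟨ ℕ.+-monoˡ-≤ (nonEdges r H (V H)) (unique⇒length≤ (distinct H)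
         (All.tabulate λ {e} e∈ → ∈-filter⁺ (_∈ₗ? E H) (∈-subsets e) e∈)) ⟩
  length (filter (_∈ₗ? E H) (subsets N)) +ⁿ nonEdges r H (V H)
    ≡⟨ cong (_+ⁿ nonEdges r H (V H)) (length-filter≡∑ (_∈ₗ? E H) (subsets N)) ⟩
  ∑ (subsets N) (λ S → 𝟙 (S ∈ₗ? E H)) +ⁿ nonEdges r H (V H)
    ≡⟨ ∑-+ (λ S → 𝟙 (S ∈ₗ? E H)) (𝟙 ∘ nonEdge? r H (V H)) (subsets N) ⟨
  ∑ (subsets N) (λ S → 𝟙 (S ∈ₗ? E H) +ⁿ 𝟙 (nonEdge? r H (V H) S))
    ≤⟨ ∑-mono-≤ (λ S → 𝟙-disjoint (S ∈ₗ? E H) (nonEdge? r H (V H) S) (block? r (V H) S)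
         (λ S∈ → (λ {x} → edge⊆V H S∈ {x}) , uniform S∈) proj₁ (λ S∈ (_ , S∉) → S∉ S∈)) (subsets N) ⟩
  ∑ (subsets N) (𝟙 ∘ block? r (V H))
    ≡⟨ ∑-block (V H) r ⟩
  order H C r ∎
  where open ℕ.≤-Reasoning

-- Rational form of the bound and the theorem

-- `toℚ` normalises its fraction, so the sum is compared among unnormalised rationals, where all
-- denominators are 1 and an integer identity remains.
toℚ-+ : ∀ m n → toℚ (m +ⁿ n) ≡ toℚ m + toℚ n
toℚ-+ m n = ℚ.toℚᵘ-injective (begin
  toℚᵘ (toℚ (m +ⁿ n))                           ≈⟨ ℚ.toℚᵘ-fromℚᵘ (ℚᵘ.mkℚᵘ (+ (m +ⁿ n)) 0) ⟩
  ℚᵘ.mkℚᵘ (+ (m +ⁿ n)) 0                        ≈⟨ ℚᵘ.*≡* (cong (ℤ._* + 1) (trans (ℤ.pos-+ m n)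
                                                     (sym (cong₂ ℤ._+_ (ℤ.*-identityʳ (+ m)) (ℤ.*-identityʳ (+ n)))))) ⟩
  ℚᵘ.mkℚᵘ (+ m) 0 ℚᵘ.+ ℚᵘ.mkℚᵘ (+ n) 0          ≈⟨ ℚᵘ.+-cong (ℚ.toℚᵘ-fromℚᵘ (ℚᵘ.mkℚᵘ (+ m) 0)) (ℚ.toℚᵘ-fromℚᵘ (ℚᵘ.mkℚᵘ (+ n) 0)) ⟨
  toℚᵘ (toℚ m) ℚᵘ.+ toℚᵘ (toℚ n)                ≈⟨ ℚ.toℚᵘ-homo-+ (toℚ m) (toℚ n) ⟨
  toℚᵘ (toℚ m + toℚ n)                          ∎)
  where open ℚᵘ.≃-Reasoning

toℚ-∸ : ∀ {m n} → n ≤ m → toℚ (m ∸ n) ≡ toℚ m - toℚ n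
toℚ-∸ {m} {n} n≤m = begin
  toℚ (m ∸ n)                        ≡⟨ ℚ.+-identityʳ _ ⟨
  toℚ (m ∸ n) + 0ℚ                   ≡⟨ cong (λ x → toℚ (m ∸ n) + x) (ℚ.+-inverseʳ (toℚ n)) ⟨
  toℚ (m ∸ n) + (toℚ n - toℚ n)      ≡⟨ ℚ.+-assoc (toℚ (m ∸ n)) (toℚ n) (- toℚ n) ⟨
  toℚ (m ∸ n) + toℚ n - toℚ n        ≡⟨ cong (_- toℚ n) (toℚ-+ (m ∸ n) n) ⟨
  toℚ (m ∸ n +ⁿ n) - toℚ n           ≡⟨ cong (λ x → toℚ x - toℚ n) (ℕ.m∸n+n≡m n≤m) ⟩
  toℚ m - toℚ n                      ∎
  where open ≡-Reasoning

theorem4p2 : (n k r : ℕ) .{{_ : NonZero k}} → 2 ≤ k → 2 ≤ r → 2 *ⁿ k ≤ n → k < r →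
    (∀ {N} (H : Hypergraph N) → order H ≡ n → VertexMaximal k r H →
    size H ≤ (n C r) ∸ ((n ∸ k) C r))
    × toℚ ((n C r) ∸ ((n ∸ k) C r))
    ≡ toℚ (n C r) - toℚ ((n ∸ k) C r) + ((+ n / k) - toℚ 2) * toℚ (k C r)
theorem4p2 n k r _ 2≤r _ k<r = bound , identity
  where
  bound : ∀ {N} (H : Hypergraph N) → order H ≡ n → VertexMaximal k r H → size H ≤ (n C r) ∸ ((n ∸ k) C r)
  -- The lower bound on non-edges is taken at `W = V H` and combined with the count of all
  -- `r`-subsets.
  bound H refl (uniform , κ̄≤k , _) = ℕ.m+n≤o⇒m≤o∸n (size H) (ℕ.≤-trans
    (ℕ.+-monoʳ-≤ (size H) (nonEdges-lower H 2≤r k<r κ̄≤k (V H) id (<-wellFounded _)))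
    (size+nonEdges H uniform))
  identity : toℚ ((n C r) ∸ ((n ∸ k) C r))
           ≡ toℚ (n C r) - toℚ ((n ∸ k) C r) + ((+ n / k) - toℚ 2) * toℚ (k C r)
  identity = begin
    -- Monotonicity of the binomial makes the truncated subtraction a genuine one; the extra summand
    -- is 0 because `k < r`.
    toℚ ((n C r) ∸ ((n ∸ k) C r))          ≡⟨ toℚ-∸ (C-monoˡ-≤ r (ℕ.m∸n≤m n k)) ⟩
    d                                      ≡⟨ ℚ.+-identityʳ d ⟨
    d + 0ℚ                                 ≡⟨ cong (λ x → d + x) (ℚ.*-zeroʳ ((+ n / k) - toℚ 2)) ⟨
    d + ((+ n / k) - toℚ 2) * toℚ 0        ≡⟨ cong (λ x → d + ((+ n / k) - toℚ 2) * toℚ x) (k>n⇒nCk≡0 k<r) ⟨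
    d + ((+ n / k) - toℚ 2) * toℚ (k C r)  ∎
    where
    open ≡-Reasoning
    d = toℚ (n C r) - toℚ ((n ∸ k) C r)
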